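{- Let $n\ge3$ and $k\ge0$ be integers with $n\le k$. If $S$ is an independent, non-reversible set in $G_n^k$, then $$|S|\le \frac{(k+1)(k+2)}{2}+2-n.$$
   Context: The crown $S_n^k$ is the height-2 poset on $A\cup B$, $A=\{a_1,\dots,a_{n+k}\}$ minimal elements, $B=\{b_1,\dots,b_{n+k}\}$ maximal elements, indices cyclic mod $n+k$; $a_i$ is incomparable to $b_j$ iff $j\in\{i,\dots,i+k\}$ (mod $n+k$), otherwise $a_i<b_j$. $\mathrm{Inc}(A,B)$ is the set of incomparable pairs $(a,b)\in A\times B$. $G_n^k$ is the graph on $\mathrm{Inc}(A,B)$ with $(a,b)\sim(x,y)$ iff $a<y$ and $x<b$. A set $S\subseteq\mathrm{Inc}(A,B)$ is reversible if there is a linear extension $L$ of $S_n^k$ with $x>y$ in $L$ for all $(x,y)\in S$. -}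

module Defs where

open import Data.Nat using (ℕ; _+_; _*_; _≤_; _<_)
open import Data.Fin using (Fin; toℕ)
open import Data.Sum using (_⊎_; inj₁; inj₂)
open import Data.Product using (_×_; _,_; ∃-syntax)
open import Data.Empty using (⊥)
open import Data.List using (List; length)
open import Data.List.Membership.Propositional using (_∈_)
open import Data.List.Relation.Unary.All using (All)
open import Data.List.Relation.Unary.Unique.Propositional using (Unique)
open import Relation.Nullary using (¬_)
open import Relation.Binary.PropositionalEquality using (_≡_)
open import Function.Definitions using (Injective)

-- The crown S_n^k has ground set A ∪ B with |A| = |B| = n + k.
-- Element (inj₁ i) is a_i, element (inj₂ j) is b_j (indices in Fin (n + k),
-- i.e. 0-based, cyclic mod n + k).
Elem : ℕ → ℕ → Set
Elem n k = Fin (n + k) ⊎ Fin (n + k)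

-- a_i is incomparable to b_j iff j ∈ {i, i+1, …, i+k} (mod n+k),
-- i.e. j ≡ i + t (mod n+k) for some 0 ≤ t ≤ k.
Incomp : (n k : ℕ) → Fin (n + k) → Fin (n + k) → Set
Incomp n k i j = ∃[ t ] ∃[ q ] (t ≤ k × toℕ i + t ≡ toℕ j + q * (n + k))

Less : (n k : ℕ) → Elem n k → Elem n k → Set
Less n k (inj₁ i) (inj₂ j) = ¬ Incomp n k i j
Less n k (inj₁ i) (inj₁ j) = ⊥
Less n k (inj₂ i) (inj₁ j) = ⊥
Less n k (inj₂ i) (inj₂ j) = ⊥

-- A linear extension of S_n^k, represented by an injective ranking of the
-- (finite) ground set into ℕ that respects the crown order:
-- x is below y in L iff rank x < rank y.
record LinearExtension (n k : ℕ) : Set where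
  field
    rank     : Elem n k → ℕ
    rank-inj : Injective _≡_ _≡_ rank
    rank-mono : ∀ x y → Less n k x y → rank x < rank y
open LinearExtension public

-- Vertices of G_n^k: incomparable pairs (a_i, b_j), encoded as (i , j).
Pair : ℕ → ℕ → Set
Pair n k = Fin (n + k) × Fin (n + k)

IsIncSet : (n k : ℕ) → List (Pair n k) → Set
IsIncSet n k S = Unique S × All (λ p → Incomp n k (Data.Product.proj₁ p) (Data.Product.proj₂ p)) S

Adj : (n k : ℕ) → Pair n k → Pair n k → Set
Adj n k (i , j) (x , y) = Less n k (inj₁ i) (inj₂ y) × Less n k (inj₁ x) (inj₂ j)

Independent : (n k : ℕ) → List (Pair n k) → Set
Independent n k S = ∀ {p q} → p ∈ S → q ∈ S → ¬ Adj n k p q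

Reversible : (n k : ℕ) → List (Pair n k) → Set
Reversible n k S = Data.Product.Σ (LinearExtension n k) λ L → All (λ p → rank L (inj₂ (Data.Product.proj₂ p)) < rank L (inj₁ (Data.Product.proj₁ p))) S

{-# OPTIONS --safe #-}
module Submission where

-- Write m = n + k and let C q be the set of x with (a_x , b_q) ∈ S.  Put an arc from q to y when
-- some x ∈ C q has a_x < b_y: a linear extension reversing S must then place b_q below b_y, and S is
-- reversible as soon as these arcs are acyclic.  Independence says that no arc occurs together with
-- its opposite.  The down-set of b_y is the window y + 1 , … , y + n − 1, so the out-neighbourhood
-- of q is C q thickened by a window; it avoids q, hence has at least |C q| + n − 2 elements when C q
-- is nonempty, and at least |C q| + 2(n − 2) if it is not an interval of the circle cut at q.
--
-- Let R be the set of q with C q nonempty, r = |R| and s = m − r.  Counting arcs,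
-- |S| + r(n − 2) ≤ r(r − 1)/2 + rs, and the theorem follows if we can improve this by n − 2 or by s.
-- The former happens if some out-neighbourhood is not an interval, the latter if every z ∉ R
-- misses an arc from R.  Otherwise cut the circle at some z ∉ R dominated by all of R.  In any set of
-- consecutive points either the first has no arc into the set or the last has none, because such
-- arcs would by convexity include the opposite pair between these two; peeling off ends orders the b's.

open import Defs
open import Data.Fin using (Fin; toℕ; join; splitAt)
open import Data.Fin.Properties using (toℕ-injective; toℕ<n; toℕ-fromℕ<; splitAt-join) renaming (_≟_ to _≟ᶠ_)
open import Data.List using (List; []; _∷_; length)
open import Data.List.Membership.Propositional using (_∈_)
open import Data.List.Relation.Unary.All as All using ()
open import Data.List.Relation.Unary.AllPairs using (_∷_)
open import Data.List.Relation.Unary.Any using (here; there)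
open import Data.List.Relation.Unary.Unique.Propositional using (Unique)
open import Data.Nat
open import Data.Nat.DivMod
open import Data.Nat.Properties
open import Data.Nat.Tactic.RingSolver using (solve-∀)
open import Data.Product using (_×_; _,_; ∃-syntax; proj₁; proj₂)
open import Data.Product.Properties using (≡-dec)
open import Data.Sum using (_⊎_; inj₁; inj₂; fromInj₁)
open import Relation.Nullary using (¬_; Dec; yes; no; contradiction)
open import Relation.Nullary.Decidable using (decidable-stable)
open import Relation.Binary.PropositionalEquality

-- Finite sums over initial segments of the naturals.

∑ : ℕ → (ℕ → ℕ) → ℕ
∑ zero    f = 0
∑ (suc n) f = ∑ n f + f n

∑-mono : ∀ n {f g} → (∀ {i} → i < n → f i ≤ g i) → ∑ n f ≤ ∑ n g
∑-mono zero    f≤g = z≤n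
∑-mono (suc n) f≤g = +-mono-≤ (∑-mono n (λ i<n → f≤g (m≤n⇒m≤1+n i<n))) (f≤g ≤-refl)

∑-cong : ∀ n {f g} → (∀ i → f i ≡ g i) → ∑ n f ≡ ∑ n g
∑-cong zero    f≡g = refl
∑-cong (suc n) f≡g = cong₂ _+_ (∑-cong n f≡g) (f≡g n)

∑-+ : ∀ n f g → ∑ n (λ i → f i + g i) ≡ ∑ n f + ∑ n g
∑-+ zero    f g = refl
∑-+ (suc n) f g rewrite ∑-+ n f g = interchange (∑ n f) (∑ n g) (f n) (g n)
  where
  interchange : ∀ a b c d → a + b + (c + d) ≡ a + c + (b + d)
  interchange = solve-∀

∑-*ʳ : ∀ n f c → ∑ n (λ i → f i * c) ≡ ∑ n f * c
∑-*ʳ zero    f c = refl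
∑-*ʳ (suc n) f c rewrite ∑-*ʳ n f c = sym (*-distribʳ-+ c (∑ n f) (f n))

∑-const : ∀ n c → ∑ n (λ _ → c) ≡ n * c
∑-const zero    c = refl
∑-const (suc n) c rewrite ∑-const n c = +-comm (n * c) c

∑-comm : ∀ m n (f : ℕ → ℕ → ℕ) →
  ∑ m (λ i → ∑ n (λ j → f i j)) ≡ ∑ n (λ j → ∑ m (λ i → f i j))
∑-comm zero    n f = sym (trans (∑-const n 0) (*-zeroʳ n))
∑-comm (suc m) n f rewrite ∑-comm m n f = sym (∑-+ n (λ j → ∑ m (λ i → f i j)) (f m))

∑-split : ∀ m n f → ∑ (m + n) f ≡ ∑ m f + ∑ n (λ i → f (m + i))
∑-split m zero    f = trans (cong (λ j → ∑ j f) (+-identityʳ m)) (sym (+-identityʳ (∑ m f)))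
∑-split m (suc n) f rewrite +-suc m n | ∑-split m n f = +-assoc (∑ m f) _ _

∑-rotate : ∀ m f → (∀ i → f (i + m) ≡ f i) → ∀ q → ∑ m (λ i → f (q + i)) ≡ ∑ m f
∑-rotate m f periodic zero    = refl
∑-rotate m f periodic (suc q) = trans (+-cancelˡ-≡ (h 0) _ _ step) (∑-rotate m f periodic q)
  where
  h = λ i → f (q + i)
  open ≡-Reasoning
  -- The windows starting at `q` and at `q + 1` are both cut out of the same m + 1 terms, whose
  -- first and last agree by periodicity.
  step : h 0 + ∑ m (λ i → f (suc q + i)) ≡ h 0 + ∑ m h
  step = begin
    h 0 + ∑ m (λ i → f (suc q + i)) ≡⟨ cong (h 0 +_) (∑-cong m (λ i → cong f (sym (+-suc q i)))) ⟩
    h 0 + ∑ m (λ i → h (suc i))     ≡⟨ ∑-split 1 m h ⟨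
    ∑ m h + h m                     ≡⟨ cong (∑ m h +_) (periodic q) ⟩
    ∑ m h + f q                     ≡⟨ cong (λ j → ∑ m h + f j) (+-identityʳ q) ⟨
    ∑ m h + h 0                     ≡⟨ +-comm (∑ m h) (h 0) ⟩
    h 0 + ∑ m h                     ∎

∑-bump : ∀ n {f g i a} → (∀ {j} → j < n → f j ≤ g j) → i < n → f i + a ≤ g i →
  ∑ n f + a ≤ ∑ n g
∑-bump (suc n) {f} {g} {i} {a} f≤g i<1+n bump with i ≟ n
... | yes refl = begin
  ∑ n f + f n + a   ≡⟨ +-assoc (∑ n f) (f n) a ⟩
  ∑ n f + (f n + a) ≤⟨ +-mono-≤ (∑-mono n (λ j<n → f≤g (m≤n⇒m≤1+n j<n))) bump ⟩
  ∑ n g + g n       ∎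
  where open ≤-Reasoning
... | no i≢n = begin
  ∑ n f + f n + a ≡⟨ swap (∑ n f) (f n) a ⟩
  ∑ n f + a + f n ≤⟨ +-mono-≤ (∑-bump n (λ j<n → f≤g (m≤n⇒m≤1+n j<n)) (≤∧≢⇒< (s≤s⁻¹ i<1+n) i≢n) bump) (f≤g ≤-refl) ⟩
  ∑ n g + g n     ∎
  where
  open ≤-Reasoning
  swap : ∀ a b c → a + b + c ≡ a + c + b
  swap = solve-∀

∑-gain : ∀ n {f g} lo len → (∀ {i} → i < n → f i ≤ g i) → lo + len ≤ n →
  (∀ {i} → lo ≤ i → i < lo + len → suc (f i) ≤ g i) → ∑ n f + len ≤ ∑ n g
∑-gain n {f} lo zero f≤g _ _ rewrite +-identityʳ (∑ n f) = ∑-mono n f≤g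
∑-gain zero lo (suc len) _ le _ = contradiction (≤-trans (m≤n+m (suc len) lo) le) λ ()
∑-gain (suc n) {f} {g} lo (suc len) f≤g le gain with lo + suc len ≤? n
... | yes le′ = begin
  ∑ n f + f n + suc len   ≡⟨ swap (∑ n f) (f n) (suc len) ⟩
  ∑ n f + suc len + f n   ≤⟨ +-mono-≤ (∑-gain n lo (suc len) (λ i<n → f≤g (m≤n⇒m≤1+n i<n)) le′ gain) (f≤g ≤-refl) ⟩
  ∑ n g + g n             ∎
  where
  open ≤-Reasoning
  swap : ∀ a b c → a + b + c ≡ a + c + b
  swap = solve-∀
-- The block ends exactly at the last index, which yields one unit; the shortened block yields the
-- rest.
... | no ≰ = begin
  ∑ n f + f n + suc len   ≡⟨ swap (∑ n f) (f n) len ⟩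
  ∑ n f + len + suc (f n) ≤⟨ +-mono-≤ (∑-gain n lo len (λ i<n → f≤g (m≤n⇒m≤1+n i<n)) (≤-reflexive end) gain′)
                                      (gain (≤-trans (m≤m+n lo len) (≤-reflexive end)) (≤-reflexive (sym end′))) ⟩
  ∑ n g + g n             ∎
  where
  open ≤-Reasoning
  swap : ∀ a b c → a + b + suc c ≡ a + c + suc b
  swap = solve-∀
  end′ : lo + suc len ≡ suc n
  end′ = ≤-antisym le (≰⇒> ≰)
  end : lo + len ≡ n
  end = suc-injective (trans (sym (+-suc lo len)) end′)
  gain′ : ∀ {i} → lo ≤ i → i < lo + len → suc (f i) ≤ g i
  gain′ lo≤i i<end = gain lo≤i (<-≤-trans i<end (+-monoʳ-≤ lo (n≤1+n len)))

-- Indicators and least witnesses.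

⟦_⟧ : ∀ {p} {P : Set p} → Dec P → ℕ
⟦ yes _ ⟧ = 1
⟦ no  _ ⟧ = 0

⟦⟧≤1 : ∀ {p} {P : Set p} (P? : Dec P) → ⟦ P? ⟧ ≤ 1
⟦⟧≤1 (yes _) = ≤-refl
⟦⟧≤1 (no  _) = z≤n

⟦⟧-true : ∀ {p} {P : Set p} (P? : Dec P) → P → ⟦ P? ⟧ ≡ 1
⟦⟧-true (yes _) p = refl
⟦⟧-true (no ¬p) p = contradiction p ¬p

⟦⟧-false : ∀ {p} {P : Set p} (P? : Dec P) → ¬ P → ⟦ P? ⟧ ≡ 0
⟦⟧-false (yes p) ¬p = contradiction p ¬p
⟦⟧-false (no  _) ¬p = refl

⟦⟧-mono : ∀ {p q} {P : Set p} {Q : Set q} (P? : Dec P) (Q? : Dec Q) → (P → Q) → ⟦ P? ⟧ ≤ ⟦ Q? ⟧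
⟦⟧-mono (yes p) Q? f = ≤-reflexive (sym (⟦⟧-true Q? (f p)))
⟦⟧-mono (no  _) Q? f = z≤n

least : ∀ {p} {P : ℕ → Set p} → (∀ i → Dec (P i)) → ∀ {i} → P i →
  ∃[ j ] (j ≤ i × P j × (∀ {l} → l < j → ¬ P l))
least {P = P} P? {i} Pi with P? 0
... | yes P0 = 0 , z≤n , P0 , λ ()
least P? {zero}  Pi | no ¬P0 = contradiction Pi ¬P0
least {P = P} P? {suc i} Pi | no ¬P0 with least (λ j → P? (suc j)) Pi
... | j , j≤i , Pj , min = suc j , s≤s j≤i , Pj , below
  where
  below : ∀ {l} → l < suc j → ¬ P l
  below {zero}  _         = ¬P0
  below {suc l} (s≤s l<j) = min l<j

-- Thickening a set by a window.

module Thickening {p} {F : ℕ → Set p} (F? : ∀ i → Dec (F i)) (ν : ℕ) where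

  -- The window has `ν + 1` points, so a nonempty interval grows by exactly `ν` when nothing is cut
  -- off.
  G : ℕ → Set p
  G v = ∃[ w ] (w < suc ν × F (suc v + w))

  G? : ∀ v → Dec (G v)
  G? v = anyUpTo? (λ w → F? (suc v + w)) (suc ν)

  shift : ∀ v → ⟦ F? (suc v) ⟧ ≤ ⟦ G? v ⟧
  shift v = ⟦⟧-mono (F? (suc v)) (G? v) λ Fv → 0 , s≤s z≤n , subst F (cong suc (sym (+-identityʳ v))) Fv

  -- The ν points just below the shift of the first element of F are gained.
  gain-from : ∀ b {L i} → ¬ G b → i < L → F (suc b + i) →
    ∑ L (λ i → ⟦ F? (suc (b + i)) ⟧) + ν ≤ ∑ L (λ i → ⟦ G? (b + i) ⟧)
  gain-from b {L} {i} ¬Gb i<L Fi with least (λ j → F? (suc b + j)) Fi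
  ... | j , j≤i , Fj , min = ∑-gain L (j ∸ ν) ν (λ {i} _ → shift (b + i))
          (subst (_≤ L) (sym lo+ν≡j) (≤-trans j≤i (<⇒≤ i<L))) gain
    where
    ν<j : ν < j
    ν<j = ≰⇒> λ j≤ν → ¬Gb (j , s≤s j≤ν , Fj)
    lo+ν≡j : j ∸ ν + ν ≡ j
    lo+ν≡j = m∸n+n≡m (<⇒≤ ν<j)
    gain : ∀ {l} → j ∸ ν ≤ l → l < j ∸ ν + ν → suc ⟦ F? (suc (b + l)) ⟧ ≤ ⟦ G? (b + l) ⟧
    gain {l} lo≤l l<hi =
      ≤-reflexive (trans (cong suc (⟦⟧-false (F? _) (min l<j))) (sym (⟦⟧-true (G? _) (j ∸ l , s≤s j∸l≤ν , reach))))
      where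
      l<j : l < j
      l<j = subst (l <_) lo+ν≡j l<hi
      j∸l≤ν : j ∸ l ≤ ν
      j∸l≤ν = m≤n+o⇒m∸n≤o j l (subst (_≤ l + ν) lo+ν≡j (+-monoˡ-≤ ν lo≤l))
      reach : F (suc (b + l) + (j ∸ l))
      reach = subst F (cong suc (trans (cong (b +_) (sym (m+[n∸m]≡n (<⇒≤ l<j)))) (sym (+-assoc b l (j ∸ l))))) Fj

  -- A gap of G splits F into two parts, each of which gains ν points.
  gain-twice : ∀ b {L i j} → ¬ G 0 → ¬ G b → i < b → F (suc i) → j < L → F (suc b + j) →
    ∑ (b + L) (λ i → ⟦ F? (suc i) ⟧) + (ν + ν) ≤ ∑ (b + L) (λ i → ⟦ G? i ⟧)
  gain-twice b {L} ¬G0 ¬Gb i<b Fi j<L Fj = begin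
    ∑ (b + L) f + (ν + ν)                        ≡⟨ cong (_+ (ν + ν)) (∑-split b L f) ⟩
    ∑ b f + ∑ L (λ i → f (b + i)) + (ν + ν)      ≡⟨ interchange (∑ b f) _ ν ⟩
    (∑ b f + ν) + (∑ L (λ i → f (b + i)) + ν)    ≤⟨ +-mono-≤ (gain-from 0 ¬G0 i<b Fi) (gain-from b ¬Gb j<L Fj) ⟩
    ∑ b g + ∑ L (λ i → g (b + i))                ≡⟨ ∑-split b L g ⟨
    ∑ (b + L) g                                  ∎
    where
    open ≤-Reasoning
    f g : ℕ → ℕ
    f i = ⟦ F? (suc i) ⟧
    g i = ⟦ G? i ⟧
    interchange : ∀ a b c → a + b + (c + c) ≡ (a + c) + (b + c)
    interchange = solve-∀

-- Ordering a segment by peeling off its ends.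

module Peeling {a} {A : ℕ → ℕ → Set a} (A? : ∀ p q → Dec (A p q)) (M : ℕ)
  (asym  : ∀ {p q} → A p q → ¬ A q p)
  (up    : ∀ {p q r} → p < q → q ≤ r → r ≤ M → A p q → A p r)
  (down  : ∀ {p q r} → q < p → r ≤ q → p ≤ M → A p q → A p r)
  where

  -- The single arc from left end to right end decides which end has no arc into the segment; that
  -- end is put on top and removed.
  height : ℕ → ℕ → ℕ → ℕ
  height zero      l p = 0
  height (suc len) l p with A? l (l + suc len)
  ... | yes _ with p ≟ l + suc len
  ...   | yes _ = suc len
  ...   | no  _ = height len l p
  height (suc len) l p | no _ with p ≟ l
  ...   | yes _ = suc len
  ...   | no  _ = height len (suc l) p

  height-≤ : ∀ len l p → height len l p ≤ len
  height-≤ zero      l p = z≤n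
  height-≤ (suc len) l p with A? l (l + suc len)
  ... | yes _ with p ≟ l + suc len
  ...   | yes _ = ≤-refl
  ...   | no  _ = m≤n⇒m≤1+n (height-≤ len l p)
  height-≤ (suc len) l p | no _ with p ≟ l
  ...   | yes _ = ≤-refl
  ...   | no  _ = m≤n⇒m≤1+n (height-≤ len (suc l) p)

  irrefl : ∀ {p q} → A p q → p ≢ q
  irrefl Apq refl = asym Apq Apq

  height-mono : ∀ len l {p q} → l + len ≤ M → l ≤ p → p ≤ l + len → l ≤ q → q ≤ l + len →
    A p q → height len l p < height len l q
  height-mono zero l {p} {q} _ l≤p p≤ l≤q q≤ Apq
    = contradiction (trans (squeeze l≤p p≤) (sym (squeeze l≤q q≤))) (irrefl Apq)
    where
    squeeze : ∀ {x} → l ≤ x → x ≤ l + 0 → x ≡ l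
    squeeze l≤x x≤ = ≤-antisym (≤-trans x≤ (≤-reflexive (+-identityʳ l))) l≤x
  height-mono (suc len) l {p} {q} r≤M l≤p p≤r l≤q q≤r Apq with A? l (l + suc len)
  ... | yes Alr with p ≟ l + suc len | q ≟ l + suc len
  ...   | yes refl | yes refl = contradiction refl (irrefl Apq)
  -- An arc leaving the right end would extend down to `l` and oppose `Alr`.
  ...   | yes refl | no q≢r   = contradiction (down (≤∧≢⇒< q≤r q≢r) l≤q r≤M Apq) (asym Alr)
  ...   | no _     | yes _    = s≤s (height-≤ len l p)
  ...   | no p≢r   | no q≢r   =
    height-mono len l (≤-trans (+-monoʳ-≤ l (n≤1+n len)) r≤M) l≤p (below p≤r p≢r) l≤q (below q≤r q≢r) Apq
    where
    below : ∀ {x} → x ≤ l + suc len → x ≢ l + suc len → x ≤ l + len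
    below x≤r x≢r = s≤s⁻¹ (≤-trans (≤∧≢⇒< x≤r x≢r) (≤-reflexive (+-suc l len)))
  height-mono (suc len) l {p} {q} r≤M l≤p p≤r l≤q q≤r Apq | no ¬Alr with p ≟ l | q ≟ l
  ...   | yes refl | yes refl = contradiction refl (irrefl Apq)
  -- An arc leaving `l` would extend up to the right end, where there is none.
  ...   | yes refl | no q≢l   = contradiction (up (≤∧≢⇒< l≤q (≢-sym q≢l)) q≤r r≤M Apq) ¬Alr
  ...   | no _     | yes _    = s≤s (height-≤ len (suc l) p)
  ...   | no p≢l   | no q≢l   =
    height-mono len (suc l) (shift r≤M) (≤∧≢⇒< l≤p (≢-sym p≢l)) (≤-trans p≤r r≡) (≤∧≢⇒< l≤q (≢-sym q≢l)) (≤-trans q≤r r≡) Apq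
    where
    r≡ : l + suc len ≤ suc l + len
    r≡ = ≤-reflexive (+-suc l len)
    shift : l + suc len ≤ M → suc l + len ≤ M
    shift = subst (_≤ M) (+-suc l len)

-- The sides differ by (k - r + 1)(k - r + 2), a product of consecutive integers and so never
-- negative. The cases keep both factors of one sign.
quadratic : ∀ r k → 3 * r + 2 * (r * k) ≤ k * k + 3 * k + 2 + r * r
quadratic r k with r ≤? k
... | yes r≤k = go (k ∸ r) (sym (m+[n∸m]≡n r≤k))
  where
  expand : ∀ r d → (r + d) * (r + d) + 3 * (r + d) + 2 + r * r ≡ 3 * r + 2 * (r * (r + d)) + (d * d + 3 * d + 2)
  expand = solve-∀
  go : ∀ d → k ≡ r + d → 3 * r + 2 * (r * k) ≤ k * k + 3 * k + 2 + r * r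
  go d refl = ≤-trans (m≤m+n _ (d * d + 3 * d + 2)) (≤-reflexive (sym (expand r d)))
... | no r≰k = go (r ∸ suc k) (sym (m+[n∸m]≡n (≰⇒> r≰k)))
  where
  expand : ∀ k g → k * k + 3 * k + 2 + (suc k + suc g) * (suc k + suc g) ≡ 3 * (suc k + suc g) + 2 * ((suc k + suc g) * k) + (suc g * g)
  expand = solve-∀
  expand₀ : ∀ k → 3 * (suc k + 0) + 2 * ((suc k + 0) * k) ≡ k * k + 3 * k + 2 + (suc k + 0) * (suc k + 0)
  expand₀ = solve-∀
  go : ∀ g → r ≡ suc k + g → 3 * r + 2 * (r * k) ≤ k * k + 3 * k + 2 + r * r
  go zero    refl = ≤-reflexive (expand₀ k)
  go (suc g) refl = ≤-trans (m≤m+n _ (suc g * g)) (≤-reflexive (sym (expand k g)))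

-- Natural numbers as representatives of residues modulo m.

module Cyclic (d : ℕ) where

  m : ℕ
  m = suc d

  opaque

    φ : ℕ → Fin m
    φ x = x mod m

    toℕ-φ : ∀ x → toℕ (φ x) ≡ x % m
    toℕ-φ x = toℕ-fromℕ< (m%n<n x m)

  φ-toℕ : ∀ i → φ (toℕ i) ≡ i
  φ-toℕ i = toℕ-injective (trans (toℕ-φ (toℕ i)) (m<n⇒m%n≡m (toℕ<n i)))

  φ-≡ : ∀ x y → x % m ≡ y % m → φ x ≡ φ y
  φ-≡ x y eq = toℕ-injective (trans (toℕ-φ x) (trans eq (sym (toℕ-φ y))))

  φ-% : ∀ {x y} → φ x ≡ φ y → x % m ≡ y % m
  φ-% {x} {y} eq = trans (sym (toℕ-φ x)) (trans (cong toℕ eq) (toℕ-φ y))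

  φ-+* : ∀ x c → φ (x + c * m) ≡ φ x
  φ-+* x c = φ-≡ (x + c * m) x ([m+kn]%n≡m%n x c m)

  φ-period : ∀ x → φ (x + m) ≡ φ x
  φ-period x = φ-≡ (x + m) x ([m+n]%n≡m%n x m)

  φ-reduce : ∀ x → φ (x % m) ≡ φ x
  φ-reduce x = φ-≡ (x % m) x (m%n%n≡m%n x m)

  φ-cong-+ʳ : ∀ {x y} c → φ x ≡ φ y → φ (x + c) ≡ φ (y + c)
  φ-cong-+ʳ {x} {y} c eq = φ-≡ (x + c) (y + c) (begin
    (x + c) % m         ≡⟨ %-distribˡ-+ x c m ⟩
    (x % m + c % m) % m ≡⟨ cong (λ r → (r + c % m) % m) (φ-% eq) ⟩
    (y % m + c % m) % m ≡⟨ %-distribˡ-+ y c m ⟨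
    (y + c) % m         ∎)
    where open ≡-Reasoning

  φ-cong-+ˡ : ∀ {x y} c → φ x ≡ φ y → φ (c + x) ≡ φ (c + y)
  φ-cong-+ˡ {x} {y} c eq = subst₂ (λ a b → φ a ≡ φ b) (+-comm x c) (+-comm y c) (φ-cong-+ʳ c eq)

  -- y * d is an additive inverse of y modulo m.
  φ-inverse : ∀ x y → φ (y + (x + y * d)) ≡ φ x
  φ-inverse x y = trans (cong φ (regroup x y d)) (φ-+* x y)
    where
    regroup : ∀ x y d → y + (x + y * d) ≡ x + y * suc d
    regroup = solve-∀

  -- Adding the inverse of `y` to both sides leaves c ≡ 0 modulo m, and `c < m` does the rest.
  φ-cancel : ∀ y {c} → c < m → φ (y + c) ≡ φ y → c ≡ 0
  φ-cancel y {c} c<m eq = trans (sym (m<n⇒m%n≡m c<m)) (φ-% {c} {0} (begin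
    φ c                 ≡⟨ φ-+* c y ⟨
    φ (c + y * m)       ≡⟨ cong φ (regroup c y d) ⟩
    φ (y + c + y * d)   ≡⟨ φ-cong-+ʳ (y * d) eq ⟩
    φ (y + y * d)       ≡⟨ cong φ (*-suc y d) ⟨
    φ (0 + y * m)       ≡⟨ φ-+* 0 y ⟩
    φ 0                 ∎))
    where
    open ≡-Reasoning
    regroup : ∀ c y d → c + y * suc d ≡ y + c + y * d
    regroup = solve-∀

  -- The forward distance from `y` to `x` round the circle; `y * d` stands for -y, which avoids
  -- truncated subtraction.
  offset : ℕ → ℕ → ℕ
  offset y x = (x + y * d) % m

  offset-< : ∀ y x → offset y x < m
  offset-< y x = m%n<n (x + y * d) m

  φ-offset : ∀ y x → φ (y + offset y x) ≡ φ x
  φ-offset y x = trans (φ-cong-+ˡ y (φ-reduce (x + y * d))) (φ-inverse x y)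

-- Finite suprema.

sup : ℕ → (ℕ → ℕ) → ℕ
sup zero    f = 0
sup (suc n) f = sup n f ⊔ f n

sup-upper : ∀ n f {i} → i < n → f i ≤ sup n f
sup-upper (suc n) f {i} i<1+n with i ≟ n
... | yes refl = m≤n⊔m (sup n f) (f n)
... | no i≢n   = ≤-trans (sup-upper n f (≤∧≢⇒< (s≤s⁻¹ i<1+n) i≢n)) (m≤m⊔n (sup n f) (f n))

sup-least : ∀ n f {b} → (∀ {i} → i < n → f i ≤ b) → sup n f ≤ b
sup-least zero    f f≤b = z≤n
sup-least (suc n) f f≤b = ⊔-lub (sup-least n f (λ i<n → f≤b (m≤n⇒m≤1+n i<n))) (f≤b ≤-refl)

-- The crown in cyclic coordinates.

module Crown (ν k : ℕ) where

  n : ℕ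
  n = suc (suc ν)

  -- With this argument `m` is `n + k` by computation, and `ν` is n - 2.
  open Cyclic (suc ν + k) public

  -- Incomparability would make `suc v + t` a multiple of m, but it lies between 1 and n - 1 + k.
  below-b : ∀ y {v} → v < suc ν → ¬ Incomp n k (φ (suc y + v)) (φ y)
  below-b y {v} v<1+ν (t , c , t≤k , eq) with φ-cancel y gap<m wraps
    where
    gap<m : suc v + t < m
    gap<m = s≤s (+-mono-≤ v<1+ν t≤k)
    open ≡-Reasoning
    wraps : φ (y + (suc v + t)) ≡ φ y
    wraps = begin
      φ (y + (suc v + t))              ≡⟨ cong φ (regroup y v t) ⟩
      φ (suc y + v + t)                ≡⟨ φ-cong-+ʳ t (φ-toℕ (φ (suc y + v))) ⟨
      φ (toℕ (φ (suc y + v)) + t)      ≡⟨ cong φ eq ⟩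
      φ (toℕ (φ y) + c * m)            ≡⟨ φ-+* (toℕ (φ y)) c ⟩
      φ (toℕ (φ y))                    ≡⟨ φ-toℕ (φ y) ⟩
      φ y                              ∎
      where
      regroup : ∀ y v t → y + (suc v + t) ≡ suc y + v + t
      regroup = solve-∀
  ... | ()

  -- Let e be the forward distance from `j` to `i`. If e = 0 or e ≥ n, then 0 or m - e ≤ k further
  -- steps from `i` reach `j`, making the pair incomparable.
  below-b⁻¹ : ∀ i j → ¬ Incomp n k i j → ∃[ v ] (v < suc ν × φ (suc (toℕ j) + v) ≡ i)
  below-b⁻¹ i j i<j = go (offset (toℕ j) (toℕ i)) (offset-< (toℕ j) (toℕ i))
                         (trans (φ-offset (toℕ j) (toℕ i)) (φ-toℕ i))
    where
    go : ∀ e → e < m → φ (toℕ j + e) ≡ i → ∃[ v ] (v < suc ν × φ (suc (toℕ j) + v) ≡ i)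
    go zero e<m eq = contradiction (0 , 0 , z≤n , cong (λ x → toℕ x + 0) (sym j≡i)) i<j
      where
      j≡i : j ≡ i
      j≡i = trans (sym (φ-toℕ j)) (trans (cong φ (sym (+-identityʳ (toℕ j)))) eq)
    go (suc v) e<m eq with v <? suc ν
    ... | yes v<1+ν = v , v<1+ν , trans (cong φ (sym (+-suc (toℕ j) v))) eq
    ... | no v≮1+ν = contradiction (m ∸ suc v , incomp (toℕ j + suc v <? m)) i<j
      where
      t≤k : m ∸ suc v ≤ k
      t≤k = m≤n+o⇒m∸n≤o m (suc v) (+-monoˡ-≤ k (s≤s (≮⇒≥ v≮1+ν)))
      position : toℕ i ≡ (toℕ j + suc v) % m
      position = trans (cong toℕ (sym eq)) (toℕ-φ (toℕ j + suc v))
      total : toℕ j + suc v + (m ∸ suc v) ≡ toℕ j + m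
      total = trans (+-assoc (toℕ j) (suc v) _) (cong (toℕ j +_) (m+[n∸m]≡n (<⇒≤ e<m)))
      -- The full turn from `j` back to `j` passes m once: after `i` (quotient 1) or already before
      -- it (quotient 0).
      incomp : Dec (toℕ j + suc v < m) → ∃[ c ] (m ∸ suc v ≤ k × toℕ i + (m ∸ suc v) ≡ toℕ j + c * m)
      incomp (yes <m) = 1 , t≤k , trans (cong (_+ (m ∸ suc v)) (trans position (m<n⇒m%n≡m <m)))
                                        (trans total (cong (toℕ j +_) (sym (+-identityʳ m))))
      incomp (no ≮m) = 0 , t≤k , +-cancelʳ-≡ m _ _ (begin
        toℕ i + (m ∸ suc v) + m                   ≡⟨ swap (toℕ i) (m ∸ suc v) m ⟩
        toℕ i + m + (m ∸ suc v)                   ≡⟨ cong (λ x → x + m + (m ∸ suc v)) reduced ⟩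
        toℕ j + suc v ∸ m + m + (m ∸ suc v)       ≡⟨ cong (_+ (m ∸ suc v)) (m∸n+n≡m (≮⇒≥ ≮m)) ⟩
        toℕ j + suc v + (m ∸ suc v)               ≡⟨ total ⟩
        toℕ j + m                                 ≡⟨ cong (_+ m) (+-identityʳ (toℕ j)) ⟨
        toℕ j + 0 + m                             ∎)
        where
        open ≡-Reasoning
        swap : ∀ a b c → a + b + c ≡ a + c + b
        swap = solve-∀
        small : toℕ j + suc v ∸ m < m
        small = +-cancelʳ-< m _ _ (subst (_< m + m) (sym (m∸n+n≡m (≮⇒≥ ≮m))) (+-mono-< (toℕ<n j) e<m))
        reduced : toℕ i ≡ toℕ j + suc v ∸ m
        reduced = trans position (trans (sym (m≤n⇒[n∸m]%m≡n%m (≮⇒≥ ≮m))) (m<n⇒m%n≡m small))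

  open import Data.List.Membership.DecPropositional (≡-dec (_≟ᶠ_ {m}) (_≟ᶠ_ {m})) using (_∈?_)

  -- By uniqueness the head fills a cell of the incidence matrix that the tail leaves empty.
  length-≤ : (S : List (Pair n k)) → Unique S →
    length S ≤ ∑ m (λ q → ∑ m (λ x → ⟦ (φ x , φ q) ∈? S ⟧))
  length-≤ []            _            = z≤n
  length-≤ (p@(i , j) ∷ S) (p∉S ∷ unique) = begin
    suc (length S)                                    ≤⟨ s≤s (length-≤ S unique) ⟩
    suc (∑ m (λ q → ∑ m (λ x → ⟦ (φ x , φ q) ∈? S ⟧))) ≡⟨ +-comm 1 _ ⟩
    ∑ m (λ q → ∑ m (λ x → ⟦ (φ x , φ q) ∈? S ⟧)) + 1   ≤⟨ ∑-bump m (λ {q} _ → ∑-mono m (λ {x} _ → extend x q)) (toℕ<n j)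
                                                           (∑-bump m (λ {x} _ → extend x (toℕ j)) (toℕ<n i) new) ⟩
    ∑ m (λ q → ∑ m (λ x → ⟦ (φ x , φ q) ∈? (p ∷ S) ⟧)) ∎
    where
    open ≤-Reasoning
    extend : ∀ x q → ⟦ (φ x , φ q) ∈? S ⟧ ≤ ⟦ (φ x , φ q) ∈? (p ∷ S) ⟧
    extend x q = ⟦⟧-mono (_ ∈? S) (_ ∈? (p ∷ S)) there
    p≡ : (φ (toℕ i) , φ (toℕ j)) ≡ p
    p≡ = cong₂ _,_ (φ-toℕ i) (φ-toℕ j)
    new : ⟦ (φ (toℕ i) , φ (toℕ j)) ∈? S ⟧ + 1 ≤ ⟦ (φ (toℕ i) , φ (toℕ j)) ∈? (p ∷ S) ⟧
    new = ≤-reflexive (trans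
      (cong (_+ 1) (⟦⟧-false (_ ∈? S) (λ p∈S → All.lookup p∉S (subst (_∈ S) p≡ p∈S) refl)))
      (sym (⟦⟧-true (_ ∈? (p ∷ S)) (here p≡))))

  -- The arcs forced by an independent set.

  module IndependentSet (S : List (Pair n k)) (independent : Independent n k S) where

    P : ℕ → ℕ → Set
    P x q = (φ x , φ q) ∈ S

    P? : ∀ x q → Dec (P x q)
    P? x q = (φ x , φ q) ∈? S

    P-cong : ∀ {x x′ q q′} → φ x ≡ φ x′ → φ q ≡ φ q′ → P x q → P x′ q′
    P-cong x≡ q≡ = subst₂ (λ i j → (i , j) ∈ S) x≡ q≡

    -- b_q is forced below b_y: some (a_x , b_q) ∈ S has a_x < b_y, where x = y + 1 + v.
    A : ℕ → ℕ → Set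
    A q y = ∃[ v ] (v < suc ν × P (suc y + v) q)

    A? : ∀ q y → Dec (A q y)
    A? q y = anyUpTo? (λ v → P? (suc y + v) q) (suc ν)

    A-cong : ∀ {q q′ y y′} → φ q ≡ φ q′ → φ y ≡ φ y′ → A q y → A q′ y′
    A-cong {y = y} {y′} q≡ y≡ (v , v< , Pv) =
      v , v< , P-cong (subst₂ (λ a b → φ a ≡ φ b) (+-suc y v) (+-suc y′ v) (φ-cong-+ʳ (suc v) y≡)) q≡ Pv

    -- The witnesses of two opposite arcs are adjacent pairs of `S`. The case y = q excludes loops.
    A-asym : ∀ {q y} → A q y → ¬ A y q
    A-asym {q} {y} (v , v< , Pv) (w , w< , Pw) = independent Pv Pw (below-b y v< , below-b q w<)

    -- Elements of C q are located by their distance from `q + 1`, the form that `gain-from` takes.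
    R : ℕ → Set
    R q = ∃[ v ] (v < m × P (suc q + v) q)

    R? : ∀ q → Dec (R q)
    R? q = anyUpTo? (λ v → P? (suc q + v) q) m

    P⇒R : ∀ {x q} → P x q → R q
    P⇒R {x} {q} Pxq = offset (suc q) x , offset-< (suc q) x , P-cong (sym (φ-offset (suc q) x)) refl Pxq

    A⇒R : ∀ q y → A q y → R q
    A⇒R q y (v , _ , Pv) = P⇒R Pv

    χ : ℕ → ℕ → ℕ
    χ x q = ⟦ P? x q ⟧

    e : ℕ → ℕ → ℕ
    e q y = ⟦ A? q y ⟧

    ρ σ column indegree : ℕ → ℕ
    ρ q = ⟦ R? q ⟧
    σ q = 1 ∸ ρ q
    column q = ∑ m (λ x → χ x q)
    indegree y = ∑ m (λ q → e q y)

    -- Out-neighbourhoods on the circle cut at q.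

    module Out (q : ℕ) where

      -- Here `F` is C q read from q, so `G` becomes the out-neighbourhood of q read from q.
      open Thickening (λ v → P? (q + v) q) ν public

      G⇒A : ∀ {v} → G v → A q (q + v)
      G⇒A {v} (w , w< , Fw) = w , w< , subst (λ x → P x q) (regroup q v w) Fw
        where
        regroup : ∀ q v w → q + (suc v + w) ≡ suc (q + v) + w
        regroup = solve-∀

      A⇒G : ∀ {v} → A q (q + v) → G v
      A⇒G {v} (w , w< , Pw) = w , w< , subst (λ x → P x q) (regroup q v w) Pw
        where
        regroup : ∀ q v w → suc (q + v) + w ≡ q + (suc v + w)
        regroup = solve-∀

      ¬G0 : ¬ G 0
      ¬G0 G0 = A-asym Aqq Aqq
        where
        Aqq : A q q
        Aqq = A-cong refl (cong φ (+-identityʳ q)) (G⇒A G0)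

      outdegree : ∑ m (λ v → ⟦ G? v ⟧) ≤ ∑ m (e q)
      outdegree = ≤-trans (∑-mono m (λ {v} _ → ⟦⟧-mono (G? v) (A? q (q + v)) G⇒A))
                          (≤-reflexive (∑-rotate m (e q) periodic q))
        where
        periodic : ∀ y → e q (y + m) ≡ e q y
        periodic y = ≤-antisym (⟦⟧-mono (A? q (y + m)) (A? q y) (A-cong refl (φ-period y)))
                               (⟦⟧-mono (A? q y) (A? q (y + m)) (A-cong refl (sym (φ-period y))))

      column-≡ : column q ≡ ∑ m (λ v → ⟦ P? (q + suc v) q ⟧)
      column-≡ = sym (trans (∑-cong m (λ v → cong (λ x → χ x q) (+-suc q v)))
                            (∑-rotate m (λ x → χ x q) periodic (suc q)))
        where
        periodic : ∀ x → χ (x + m) q ≡ χ x q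
        periodic x = cong (λ i → ⟦ (i , φ q) ∈? S ⟧) (φ-period x)

      -- A point `v` missed between two out-neighbours has elements of C q on both sides, so
      -- `gain-twice` applies with gaps at 0 and `v`.
      convex-or-gain : ∀ {u v w} → u ≤ v → v ≤ w → w < m → A q (q + u) → A q (q + w) →
        A q (q + v) ⊎ (column q + (ν + ν) ≤ ∑ m (e q))
      convex-or-gain {u} {v} {w} u≤v v≤w w<m Au Aw with A? q (q + v)
      ... | yes Av = inj₁ Av
      ... | no ¬Av = inj₂ (begin
        column q + (ν + ν)                                    ≡⟨ cong (_+ (ν + ν)) column-≡ ⟩
        ∑ m (λ i → ⟦ P? (q + suc i) q ⟧) + (ν + ν)            ≡⟨ cong (λ l → ∑ l (λ i → ⟦ P? (q + suc i) q ⟧) + (ν + ν)) v+L≡m ⟨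
        ∑ (v + L) (λ i → ⟦ P? (q + suc i) q ⟧) + (ν + ν)      ≤⟨ twice (A⇒G Au) (A⇒G Aw) ⟩
        ∑ (v + L) (λ i → ⟦ G? i ⟧)                            ≡⟨ cong (λ l → ∑ l (λ i → ⟦ G? i ⟧)) v+L≡m ⟩
        ∑ m (λ i → ⟦ G? i ⟧)                                  ≤⟨ outdegree ⟩
        ∑ m (e q)                                             ∎)
        where
        open ≤-Reasoning
        L : ℕ
        L = m ∸ v
        v+L≡m : v + L ≡ m
        v+L≡m = m+[n∸m]≡n (≤-trans v≤w (<⇒≤ w<m))
        ¬Gv : ¬ G v
        ¬Gv Gv = ¬Av (G⇒A Gv)
        F : ℕ → Set
        F x = P (q + x) q
        twice : G u → G w → ∑ (v + L) (λ i → ⟦ P? (q + suc i) q ⟧) + (ν + ν) ≤ ∑ (v + L) (λ i → ⟦ G? i ⟧)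
        twice (a , a< , Fa) (b , b< , Fb) =
          gain-twice v {L} {u + a} {w + b ∸ v} ¬G0 ¬Gv u+a<v Fa right-< (subst F (cong suc (sym v+)) Fb)
          where
          u+a<v : u + a < v
          -- Were the witness for `u` beyond `v`, it would lie in the window of `v`.
          u+a<v = ≰⇒> λ v≤u+a → ¬Gv (u + a ∸ v ,
            ≤-<-trans (m≤n+o⇒m∸n≤o (u + a) v (+-monoˡ-≤ a u≤v)) a< ,
            subst F (cong suc (sym (m+[n∸m]≡n v≤u+a))) Fa)
          v+ : v + (w + b ∸ v) ≡ w + b
          v+ = m+[n∸m]≡n (≤-trans v≤w (m≤m+n w b))
          w+b<m : w + b < m
          -- Were the witness for `w` past the cut, it would lie in the window of q itself.
          w+b<m = ≰⇒> λ m≤w+b → ¬G0 (w + b ∸ m ,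
            ≤-<-trans (m≤n+o⇒m∸n≤o (w + b) m (+-monoˡ-≤ b (<⇒≤ w<m))) b< ,
            P-cong (trans (cong φ (wrap m≤w+b)) (φ-period _)) refl Fb)
            where
            wrap : m ≤ w + b → q + suc (w + b) ≡ q + suc (w + b ∸ m) + m
            wrap m≤w+b = trans (cong (λ x → q + suc x) (sym (m∸n+n≡m m≤w+b))) (sym (+-assoc q (suc (w + b ∸ m)) m))
          right-< : w + b ∸ v < L
          right-< = ∸-monoˡ-< w+b<m (≤-trans v≤w (m≤m+n w b))

      -- As q is not its own out-neighbour, `gain-from` applies to the whole circle cut at q; an
      -- empty C q has column sum 0.
      column-gain : column q + ρ q * ν ≤ ∑ m (e q)
      column-gain with R? q
      ... | yes (v , v<m , Pv) = begin
        column q + (ν + 0)                               ≡⟨ cong₂ _+_ column-≡ (+-identityʳ ν) ⟩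
        ∑ m (λ i → ⟦ P? (q + suc i) q ⟧) + ν             ≤⟨ gain-from 0 ¬G0 v<m (subst (λ x → P x q) (sym (+-suc q v)) Pv) ⟩
        ∑ m (λ i → ⟦ G? i ⟧)                             ≤⟨ outdegree ⟩
        ∑ m (e q)                                        ∎
        where open ≤-Reasoning
      ... | no ¬R = ≤-trans (≤-reflexive (+-identityʳ (column q))) (∑-mono m (λ {x} _ →
        ≤-trans (≤-reflexive (⟦⟧-false (P? x q) (λ Pxq → ¬R (P⇒R Pxq)))) z≤n))

    -- Counting arcs.

    open Out using (column-gain; convex-or-gain)

    -- `E` counts all arcs and `T` those whose head lies outside `R`.
    r s E T : ℕ
    r = ∑ m ρ
    s = ∑ m σ
    E = ∑ m (λ q → ∑ m (e q))
    T = ∑ m (λ y → indegree y * σ y)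

    r+s≡m : r + s ≡ m
    r+s≡m = trans (sym (∑-+ m ρ σ)) (trans (∑-cong m (λ q → m+[n∸m]≡n (⟦⟧≤1 (R? q)))) (trans (∑-const m 1) (*-identityʳ m)))

    -- At most one of the two arcs exists and its tail is in `R`. The first summand pays for it if
    -- its head is in `R` too, a `σ` summand otherwise.
    pair-bound : ∀ q y → e q y + e y q ≤ ρ y * ρ q + e q y * σ y + e y q * σ q
    pair-bound q y with A? q y | A? y q | R? q | R? y
    ... | yes a | yes b | _     | _     = contradiction b (A-asym a)
    ... | yes a | _     | no ¬r | _     = contradiction (A⇒R q y a) ¬r
    ... | _     | yes b | _     | no ¬r = contradiction (A⇒R y q b) ¬r
    ... | yes a | no _  | yes _ | yes _ = ≤-refl
    ... | yes a | no _  | yes _ | no _  = ≤-refl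
    ... | no _  | yes b | yes _ | yes _ = ≤-refl
    ... | no _  | yes b | no _  | yes _ = ≤-refl
    ... | no _  | no _  | _     | _     = z≤n

    -- There are no loops, so the diagonal summand `ρ q * ρ q` is left over.
    diagonal-bound : ∀ q → e q q + e q q + ρ q ≤ ρ q * ρ q + e q q * σ q + e q q * σ q
    diagonal-bound q with A? q q | R? q
    ... | yes a | _     = contradiction a (A-asym a)
    ... | no _  | yes _ = ≤-refl
    ... | no _  | no _  = ≤-refl

    -- This is E - T ≤ r(r - 1)/2, doubled: `pair-bound` is summed over ordered pairs, and the
    -- diagonal supplies the extra `r`.
    arcs-bound : E + E + r ≤ r * r + T + T
    arcs-bound = begin
      E + E + r
        ≡⟨ cong (λ x → E + x + r) (∑-comm m m e) ⟩
      E + ∑ m (λ q → ∑ m (λ y → e y q)) + r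
        ≡⟨ cong (_+ r) (∑-+ m (λ q → ∑ m (e q)) (λ q → ∑ m (λ y → e y q))) ⟨
      ∑ m (λ q → ∑ m (e q) + ∑ m (λ y → e y q)) + r
        ≡⟨ ∑-+ m (λ q → ∑ m (e q) + ∑ m (λ y → e y q)) ρ ⟨
      ∑ m (λ q → ∑ m (e q) + ∑ m (λ y → e y q) + ρ q)
        ≡⟨ ∑-cong m (λ q → cong (_+ ρ q) (∑-+ m (e q) (λ y → e y q))) ⟨
      ∑ m (λ q → ∑ m (λ y → e q y + e y q) + ρ q)
        ≤⟨ ∑-mono m (λ {q} q<m → ∑-bump m (λ {y} _ → pair-bound q y) q<m (diagonal-bound q)) ⟩
      ∑ m (λ q → ∑ m (λ y → ρ y * ρ q + e q y * σ y + e y q * σ q))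
        ≡⟨ ∑-cong m (λ q → trans (∑-+ m (λ y → ρ y * ρ q + e q y * σ y) (λ y → e y q * σ q))
                                 (cong₂ _+_ (∑-+ m (λ y → ρ y * ρ q) (λ y → e q y * σ y)) (∑-*ʳ m (λ y → e y q) (σ q)))) ⟩
      ∑ m (λ q → ∑ m (λ y → ρ y * ρ q) + ∑ m (λ y → e q y * σ y) + indegree q * σ q)
        ≡⟨ trans (∑-+ m (λ q → ∑ m (λ y → ρ y * ρ q) + ∑ m (λ y → e q y * σ y)) (λ q → indegree q * σ q))
                 (cong (_+ T) (∑-+ m (λ q → ∑ m (λ y → ρ y * ρ q)) (λ q → ∑ m (λ y → e q y * σ y)))) ⟩
      ∑ m (λ q → ∑ m (λ y → ρ y * ρ q)) + ∑ m (λ q → ∑ m (λ y → e q y * σ y)) + T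
        ≡⟨ cong₂ (λ a b → a + b + T) square off-R ⟩
      r * r + T + T ∎
      where
      open ≤-Reasoning
      square : ∑ m (λ q → ∑ m (λ y → ρ y * ρ q)) ≡ r * r
      square = trans (∑-cong m (λ q → trans (∑-*ʳ m ρ (ρ q)) (*-comm r (ρ q)))) (∑-*ʳ m ρ r)
      off-R : ∑ m (λ q → ∑ m (λ y → e q y * σ y)) ≡ T
      off-R = trans (∑-comm m m (λ q y → e q y * σ y)) (∑-cong m (λ y → ∑-*ʳ m (λ q → e q y) (σ y)))

    e≤ρ : ∀ q y → e q y ≤ ρ q
    e≤ρ q y = ⟦⟧-mono (A? q y) (R? q) (A⇒R q y)

    T-bound : T ≤ s * r
    T-bound = ≤-trans (∑-mono m (λ {y} _ → ≤-trans (*-monoˡ-≤ (σ y) (∑-mono m (λ {q} _ → e≤ρ q y))) (≤-reflexive (*-comm r (σ y)))))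
                      (≤-reflexive (∑-*ʳ m σ r))

    Sink : ℕ → Set
    Sink z = ¬ R z × (∀ {q} → q < m → R q → A q z)

    -- Each of the `s` points outside `R` misses at least one of its `r` possible arcs.
    T-bound-no-sink : (∀ {z} → z < m → ¬ Sink z) → T + s ≤ s * r
    T-bound-no-sink no-sink = begin
      T + s                                ≡⟨ ∑-+ m (λ y → indegree y * σ y) σ ⟨
      ∑ m (λ y → indegree y * σ y + σ y)   ≤⟨ ∑-mono m bound ⟩
      ∑ m (λ y → σ y * r)                  ≡⟨ ∑-*ʳ m σ r ⟩
      s * r                                ∎
      where
      open ≤-Reasoning
      indegree-< : ∀ {y} → y < m → ¬ R y → indegree y < r
      indegree-< {y} y<m ¬Ry = ≰⇒> λ r≤ → no-sink y<m (¬Ry , λ {q} q<m Rq → decidable-stable (A? q y) λ ¬A →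
        <⇒≱ (<-≤-trans (≤-reflexive (+-comm 1 _)) (∑-bump m (λ {q} _ → e≤ρ q y) q<m
          (≤-reflexive (trans (cong (_+ 1) (⟦⟧-false (A? q y) ¬A)) (sym (⟦⟧-true (R? q) Rq)))))) r≤)
      bound : ∀ {y} → y < m → indegree y * σ y + σ y ≤ σ y * r
      bound {y} y<m with R? y
      ... | yes _  = ≤-reflexive (trans (+-identityʳ _) (*-zeroʳ (indegree y)))
      ... | no ¬Ry = ≤-trans (≤-reflexive (trans (cong (_+ 1) (*-identityʳ _)) (+-comm _ 1)))
                             (≤-trans (indegree-< y<m ¬Ry) (≤-reflexive (sym (+-identityʳ r))))

    size : ℕ
    size = ∑ m column

    size-bound : size + r * ν ≤ E
    size-bound = begin
      size + r * ν                   ≡⟨ cong (size +_) (∑-*ʳ m ρ ν) ⟨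
      size + ∑ m (λ q → ρ q * ν)     ≡⟨ ∑-+ m column (λ q → ρ q * ν) ⟨
      ∑ m (λ q → column q + ρ q * ν) ≤⟨ ∑-mono m (λ {q} _ → column-gain q) ⟩
      E                              ∎
      where open ≤-Reasoning

    -- At `q` the gain 2ν replaces a summand of at most `ν`, so `ν` remains.
    size-bound-gain : ∀ {q} → q < m → column q + (ν + ν) ≤ ∑ m (e q) → size + r * ν + ν ≤ E
    size-bound-gain {q} q<m gain = begin
      size + r * ν + ν                   ≡⟨ cong (λ x → size + x + ν) (∑-*ʳ m ρ ν) ⟨
      size + ∑ m (λ q → ρ q * ν) + ν     ≡⟨ cong (_+ ν) (∑-+ m column (λ q → ρ q * ν)) ⟨
      ∑ m (λ q → column q + ρ q * ν) + ν ≤⟨ ∑-bump m (λ {q} _ → column-gain q) q<m bump ⟩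
      E                                  ∎
      where
      open ≤-Reasoning
      bump : column q + ρ q * ν + ν ≤ ∑ m (e q)
      bump = ≤-trans (≤-reflexive (+-assoc (column q) (ρ q * ν) ν))
        (≤-trans (+-monoʳ-≤ (column q) (+-monoˡ-≤ ν (≤-trans (*-monoˡ-≤ ν (⟦⟧≤1 (R? q))) (≤-reflexive (+-identityʳ ν))))) gain)

    -- From a potential on the b's to a reversing linear extension.

    Reversed : (ℕ → ℕ) → Set
    Reversed β = ∀ {q y} → q < m → y < m → A q y → β q < β y

    module Extension (β : ℕ → ℕ) (reversed : Reversed β) where

      -- The least level above every b paired with a_i in `S`, and 0 if there is none.
      ceiling : Fin m → ℕ
      ceiling i = sup m (λ q → χ (toℕ i) q * suc (β q))

      -- Odd levels for the b's and even ones for the a's, so that a_i falls strictly between the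
      -- b's with `β` below its ceiling and the others.
      key : Elem n k → ℕ
      key (inj₁ i) = 2 * ceiling i
      key (inj₂ j) = suc (2 * β (toℕ j))

      -- Lexicographic: `key` first, then the position in the ground set to break ties.
      rank′ : Elem n k → ℕ
      rank′ x = toℕ (join m m x) + key x * (m + m)

      rank′-injective : ∀ {x y} → rank′ x ≡ rank′ y → x ≡ y
      rank′-injective {x} {y} eq = trans (sym (splitAt-join m m x))
        (trans (cong (splitAt m) (toℕ-injective (trans (sym (index x)) (trans (cong (_% (m + m)) eq) (index y)))))
               (splitAt-join m m y))
        where
        index : ∀ x → rank′ x % (m + m) ≡ toℕ (join m m x)
        index x = trans ([m+kn]%n≡m%n (toℕ (join m m x)) (key x) (m + m)) (m<n⇒m%n≡m (toℕ<n (join m m x)))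

      key⇒rank : ∀ x y → key x < key y → rank′ x < rank′ y
      key⇒rank x y x<y = begin-strict
        toℕ (join m m x) + key x * (m + m) <⟨ +-monoˡ-< (key x * (m + m)) (toℕ<n (join m m x)) ⟩
        suc (key x) * (m + m)              ≤⟨ *-monoˡ-≤ (m + m) x<y ⟩
        key y * (m + m)                    ≤⟨ m≤n+m (key y * (m + m)) (toℕ (join m m y)) ⟩
        rank′ y                            ∎
        where open ≤-Reasoning

      -- If a_i lies below b_j, every b_q paired with a_i has an arc to b_j, and `β` increases along
      -- it.
      ceiling-≤ : ∀ i j → ¬ Incomp n k i j → ceiling i ≤ β (toℕ j)
      ceiling-≤ i j i<j = sup-least m _ bound
        where
        bound : ∀ {q} → q < m → χ (toℕ i) q * suc (β q) ≤ β (toℕ j)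
        bound {q} q<m with P? (toℕ i) q | below-b⁻¹ i j i<j
        ... | no _   | _ = z≤n
        ... | yes Pi | v , v< , i≡ = ≤-trans (≤-reflexive (+-identityʳ (suc (β q))))
          (reversed q<m (toℕ<n j) (v , v< , P-cong (trans (φ-toℕ i) (sym i≡)) refl Pi))

      ceiling-> : ∀ i j → (i , j) ∈ S → β (toℕ j) < ceiling i
      ceiling-> i j ij∈S = ≤-trans
        (≤-reflexive (sym (trans (cong (_* suc (β (toℕ j))) (⟦⟧-true (P? (toℕ i) (toℕ j)) Pij)) (+-identityʳ _))))
        (sup-upper m (λ q → χ (toℕ i) q * suc (β q)) (toℕ<n j))
        where
        Pij : P (toℕ i) (toℕ j)
        Pij = subst₂ (λ a b → (a , b) ∈ S) (sym (φ-toℕ i)) (sym (φ-toℕ j)) ij∈S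

      monotone : ∀ x y → Less n k x y → rank′ x < rank′ y
      monotone (inj₁ i) (inj₂ j) i<j = key⇒rank (inj₁ i) (inj₂ j) (s≤s (*-monoʳ-≤ 2 (ceiling-≤ i j i<j)))
      monotone (inj₁ i) (inj₁ j) ()
      monotone (inj₂ i) (inj₁ j) ()
      monotone (inj₂ i) (inj₂ j) ()

      reversible : Reversible n k S
      reversible = record { rank = rank′ ; rank-inj = rank′-injective ; rank-mono = monotone }
                 , All.tabulate λ {(i , j)} ij∈S → key⇒rank (inj₂ j) (inj₁ i)
                     (≤-trans (≤-reflexive (sym (*-suc 2 (β (toℕ j))))) (*-monoʳ-≤ 2 (ceiling-> i j ij∈S)))

    -- A potential from a sink, when out-neighbourhoods are intervals.

    Convex : Set
    Convex = ∀ {q u v w} → q < m → u ≤ v → v ≤ w → w < m → A q (q + u) → A q (q + w) → A q (q + v)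

    module FromSink (convex : Convex) {z : ℕ} (sink : Sink z) where

      convex′ : ∀ q {u v w} → u ≤ v → v ≤ w → w < m → A q (q + u) → A q (q + w) → A q (q + v)
      convex′ q {u} {v} {w} u≤v v≤w w<m Au Aw = A-cong (φ-reduce q) (φ-cong-+ʳ v (φ-reduce q))
        (convex (m%n<n q m) u≤v v≤w w<m
          (A-cong (sym (φ-reduce q)) (φ-cong-+ʳ u (sym (φ-reduce q))) Au)
          (A-cong (sym (φ-reduce q)) (φ-cong-+ʳ w (sym (φ-reduce q))) Aw))

      A⇒Az : ∀ q y → A q y → A q z
      A⇒Az q y Aqy = A-cong (φ-reduce q) refl
        (proj₂ sink (m%n<n q m) (A⇒R (q % m) y (A-cong (sym (φ-reduce q)) refl Aqy)))

      -- Positions are counted from the sink, which becomes position 0.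
      A′ : ℕ → ℕ → Set
      A′ p q = A (z + p) (z + q)

      ¬A′0 : ∀ q → ¬ A′ 0 q
      ¬A′0 q A0q = proj₁ sink (A⇒R z (z + q) (A-cong (cong φ (+-identityʳ z)) refl A0q))

      -- Seen from z + p, the point z + q is at distance q − p, and q + (m − p) if q < p; z is at distance m − p.
      around : ∀ {p} q → p ≤ m → φ (z + p + (q + (m ∸ p))) ≡ φ (z + q)
      around {p} q p≤m = trans (cong φ (trans (regroup z p q (m ∸ p)) (cong (z + q +_) (m+[n∸m]≡n p≤m)))) (φ-period (z + q))
        where
        regroup : ∀ z p q t → z + p + (q + t) ≡ z + q + (p + t)
        regroup = solve-∀

      ahead : ∀ {p q} → p ≤ q → φ (z + p + (q ∸ p)) ≡ φ (z + q)
      ahead {p} {q} p≤q = cong φ (trans (+-assoc z p (q ∸ p)) (cong (z +_) (m+[n∸m]≡n p≤q)))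

      A′-sink : ∀ {p q} → p ≤ m → A′ p q → A (z + p) (z + p + (m ∸ p))
      A′-sink {p} {q} p≤m Apq = A-cong refl (sym (trans (around 0 p≤m) (cong φ (+-identityʳ z)))) (A⇒Az (z + p) (z + q) Apq)

      -- Going forward from `p` one meets `q`, then `r`, then the sink; the first and last are
      -- out-neighbours.
      up : ∀ {p q r} → p < q → q ≤ r → r ≤ suc ν + k → A′ p q → A′ p r
      -- Position 0 is the sink, which has no outgoing arc; for other `p` the distance `m ∸ p` is
      -- below m.
      up {zero}      {q} _   _   _   A0q = contradiction A0q (¬A′0 q)
      up {p@(suc p′)} {q} {r} p<q q≤r r≤M Apq = A-cong refl (ahead (≤-trans (<⇒≤ p<q) q≤r))
        (convex′ (z + p) (∸-monoˡ-≤ p q≤r) (∸-monoˡ-≤ p (m≤n⇒m≤1+n r≤M)) (s≤s (m∸n≤m (suc ν + k) p′))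
          (A-cong refl (sym (ahead (<⇒≤ p<q))) Apq)
          (A′-sink (≤-trans (<⇒≤ p<q) (≤-trans q≤r (m≤n⇒m≤1+n r≤M))) Apq))

      -- Going forward from `p` one meets the sink, then `r`, then `q`; the first and last are
      -- out-neighbours.
      down : ∀ {p q r} → q < p → r ≤ q → p ≤ suc ν + k → A′ p q → A′ p r
      down {p} {q} {r} q<p r≤q p≤M Apq = A-cong refl (around r p≤m)
        (convex′ (z + p) (m≤n+m (m ∸ p) r) (+-monoˡ-≤ (m ∸ p) r≤q)
          (<-≤-trans (+-monoˡ-< (m ∸ p) q<p) (≤-reflexive (m+[n∸m]≡n p≤m)))
          (A′-sink p≤m Apq)
          (A-cong refl (sym (around q p≤m)) Apq))
        where
        p≤m : p ≤ m
        p≤m = m≤n⇒m≤1+n p≤M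

      -- The last position on the cut circle is `suc ν + k`, that is m - 1.
      open Peeling (λ p q → A? (z + p) (z + q)) (suc ν + k) (λ {p} {q} → A-asym {z + p} {z + q}) up down

      β : ℕ → ℕ
      β q = height (suc ν + k) 0 (offset z q)

      β-reversed : Reversed β
      β-reversed {q} {y} _ _ Aqy = height-mono (suc ν + k) 0 ≤-refl z≤n (s≤s⁻¹ (offset-< z q)) z≤n (s≤s⁻¹ (offset-< z y))
        (A-cong (sym (φ-offset z q)) (sym (φ-offset z y)) Aqy)

    -- The two numerical bounds and the conclusion.

    Bound : ℕ → Set
    Bound N = 2 * N + 2 * n ≤ (k + 1) * (k + 2) + 4

    -- The chain is 2(size + rν + ν) + r ≤ 2E + r ≤ r² + 2sr with s = m - r, then `quadratic`. The
    -- addend cancelled at the end absorbs all negative terms.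
    bound-from-gain : ∀ {q} → q < m → column q + (ν + ν) ≤ ∑ m (e q) → Bound size
    bound-from-gain q<m gain = +-cancelʳ-≤ (3 * r + r * r + 2 * (r * ν) + r * r) _ _ (begin
      2 * size + 2 * n + (3 * r + r * r + 2 * (r * ν) + r * r)    ≡⟨ e₁ size ν r ⟩
      2 * (size + r * ν + ν) + r + (2 * r + r * r + r * r + 4)    ≤⟨ +-monoˡ-≤ _ (+-monoˡ-≤ r (*-monoʳ-≤ 2 (size-bound-gain q<m gain))) ⟩
      2 * E + r + (2 * r + r * r + r * r + 4)                     ≡⟨ e₂ E r ⟩
      E + E + r + (2 * r + r * r + r * r + 4)                     ≤⟨ +-monoˡ-≤ _ (≤-trans arcs-bound (+-mono-≤ (+-monoʳ-≤ (r * r) T-bound) T-bound)) ⟩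
      r * r + s * r + s * r + (2 * r + r * r + r * r + 4)         ≡⟨ e₃ r s ⟩
      2 * (r * (r + s)) + r * r + 2 * r + 4                       ≡⟨ cong (λ x → 2 * (r * x) + r * r + 2 * r + 4) r+s≡m ⟩
      2 * (r * m) + r * r + 2 * r + 4                             ≡⟨ e₄ r ν k ⟩
      3 * r + 2 * (r * k) + (3 * r + 2 * (r * ν) + r * r + 4)     ≤⟨ +-monoˡ-≤ _ (quadratic r k) ⟩
      k * k + 3 * k + 2 + r * r + (3 * r + 2 * (r * ν) + r * r + 4) ≡⟨ e₅ r ν k ⟩
      (k + 1) * (k + 2) + 4 + (3 * r + r * r + 2 * (r * ν) + r * r) ∎)
      where
      open ≤-Reasoning
      e₁ : ∀ N ν r → 2 * N + 2 * suc (suc ν) + (3 * r + r * r + 2 * (r * ν) + r * r) ≡ 2 * (N + r * ν + ν) + r + (2 * r + r * r + r * r + 4)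
      e₁ = solve-∀
      e₂ : ∀ E r → 2 * E + r + (2 * r + r * r + r * r + 4) ≡ E + E + r + (2 * r + r * r + r * r + 4)
      e₂ = solve-∀
      e₃ : ∀ r s → r * r + s * r + s * r + (2 * r + r * r + r * r + 4) ≡ 2 * (r * (r + s)) + r * r + 2 * r + 4
      e₃ = solve-∀
      e₄ : ∀ r ν k → 2 * (r * suc (suc ν + k)) + r * r + 2 * r + 4 ≡ 3 * r + 2 * (r * k) + (3 * r + 2 * (r * ν) + r * r + 4)
      e₄ = solve-∀
      e₅ : ∀ r ν k → k * k + 3 * k + 2 + r * r + (3 * r + 2 * (r * ν) + r * r + 4) ≡ (k + 1) * (k + 2) + 4 + (3 * r + r * r + 2 * (r * ν) + r * r)
      e₅ = solve-∀

    -- Now T ≤ sr - s. Since -2s = 2r - 2m, the saving raises the coefficient of r, so `quadratic`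
    -- is taken at `k + 1`.
    bound-from-no-sink : (∀ {z} → z < m → ¬ Sink z) → Bound size
    bound-from-no-sink no-sink = +-cancelʳ-≤ (2 * k + 2 * (r * ν) + r * r + r) _ _ (begin
      2 * size + 2 * n + (2 * k + 2 * (r * ν) + r * r + r)        ≡⟨ e₁ size ν r k ⟩
      2 * (size + r * ν) + r + (2 * m + r * r)                    ≤⟨ +-monoˡ-≤ _ (+-monoˡ-≤ r (*-monoʳ-≤ 2 size-bound)) ⟩
      2 * E + r + (2 * m + r * r)                                 ≡⟨ cong (λ x → 2 * E + r + (2 * x + r * r)) r+s≡m ⟨
      2 * E + r + (2 * (r + s) + r * r)                           ≡⟨ e₂ E r s ⟩
      E + E + r + (s + s + (2 * r + r * r))                       ≤⟨ +-monoˡ-≤ _ arcs-bound ⟩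
      r * r + T + T + (s + s + (2 * r + r * r))                   ≡⟨ e₃ r s T ⟩
      r * r + (T + s) + (T + s) + (2 * r + r * r)                 ≤⟨ +-monoˡ-≤ _ (+-mono-≤ (+-monoʳ-≤ (r * r) T+s≤) T+s≤) ⟩
      r * r + s * r + s * r + (2 * r + r * r)                     ≡⟨ e₄ r s ⟩
      2 * (r * (r + s)) + 2 * r                                   ≡⟨ cong (λ x → 2 * (r * x) + 2 * r) r+s≡m ⟩
      2 * (r * m) + 2 * r                                         ≡⟨ e₅ r ν k ⟩
      3 * r + 2 * (r * (k + 1)) + (2 * (r * ν) + r)               ≤⟨ +-monoˡ-≤ _ (quadratic r (k + 1)) ⟩
      (k + 1) * (k + 1) + 3 * (k + 1) + 2 + r * r + (2 * (r * ν) + r) ≡⟨ e₆ r ν k ⟩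
      (k + 1) * (k + 2) + 4 + (2 * k + 2 * (r * ν) + r * r + r)   ∎)
      where
      open ≤-Reasoning
      T+s≤ : T + s ≤ s * r
      T+s≤ = T-bound-no-sink no-sink
      e₁ : ∀ N ν r k → 2 * N + 2 * suc (suc ν) + (2 * k + 2 * (r * ν) + r * r + r) ≡ 2 * (N + r * ν) + r + (2 * suc (suc ν + k) + r * r)
      e₁ = solve-∀
      e₂ : ∀ E r s → 2 * E + r + (2 * (r + s) + r * r) ≡ E + E + r + (s + s + (2 * r + r * r))
      e₂ = solve-∀
      e₃ : ∀ r s T → r * r + T + T + (s + s + (2 * r + r * r)) ≡ r * r + (T + s) + (T + s) + (2 * r + r * r)
      e₃ = solve-∀
      e₄ : ∀ r s → r * r + s * r + s * r + (2 * r + r * r) ≡ 2 * (r * (r + s)) + 2 * r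
      e₄ = solve-∀
      e₅ : ∀ r ν k → 2 * (r * suc (suc ν + k)) + 2 * r ≡ 3 * r + 2 * (r * (k + 1)) + (2 * (r * ν) + r)
      e₅ = solve-∀
      e₆ : ∀ r ν k → (k + 1) * (k + 1) + 3 * (k + 1) + 2 + r * r + (2 * (r * ν) + r) ≡ (k + 1) * (k + 2) + 4 + (2 * k + 2 * (r * ν) + r * r + r)
      e₆ = solve-∀

    bound : ¬ Reversible n k S → Bound size
    -- If the bound fails, no column has the double gain, so `Convex` holds; a sink would then make
    -- `S` reversible, and without a sink the bound follows.
    bound irreversible = decidable-stable (_ ≤? _) λ ¬bound →
      let convex : Convex
          convex {q} q<m u≤v v≤w w<m Au Aw =
            fromInj₁ (λ gain → contradiction (bound-from-gain q<m gain) ¬bound) (convex-or-gain q u≤v v≤w w<m Au Aw)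
      in ¬bound (bound-from-no-sink λ _ sink →
           irreversible (Extension.reversible (FromSink.β convex sink) (FromSink.β-reversed convex sink)))

theorem1p6 : (n k : ℕ) → 3 ≤ n → n ≤ k →
    (S : List (Pair n k)) → IsIncSet n k S → Independent n k S → ¬ Reversible n k S →
    2 * length S + 2 * n ≤ (k + 1) * (k + 2) + 4
theorem1p6 (suc (suc ν)) k _ _ S (unique , _) independent irreversible =
  ≤-trans (+-monoˡ-≤ (2 * suc (suc ν)) (*-monoʳ-≤ 2 (length-≤ S unique))) (bound irreversible)
  where
  open Crown ν k
  open IndependentSet S independent
theorem1p6 (suc zero) k (s≤s ())
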